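{- Let $G$ be a finite perfect graph, and let $f$ be a positive real-valued function on the set of pairs $(H,v)$ where $H$ is an induced subgraph of $G$ and $v\in V(H)$. Assume that: (i) $f(H,v)\le f(G[V(H)\cup\{w\}],v)$ for every induced subgraph $H$ of $G$, every $v\in V(H)$ and every $w\in V(G)\setminus V(H)$; (ii) for every induced subgraph $H$ of $G$ whose vertex set is an independent set of $G$, $\sum_{v\in V(H)}\frac{1}{f(H,v)}\le 1$. For an induced subgraph $H$ of $G$ and $v\in V(H)$, let $c(H,v)$ be the size of the largest clique of $H$ containing $v$. Then for every induced subgraph $H$ of $G$, \[ \sum_{v\in V(H)}\frac{1}{f(H,v)\,c(H,v)}\le 1. \]
   Context: A graph $G$ is perfect if for every induced subgraph its chromatic number equals its clique number. $G[S]$ denotes the subgraph of $G$ induced by the vertex set $S$. -}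

module Defs where

open import Level using (0ℓ) renaming (suc to lsuc)
open import Algebra.Bundles.Raw using (RawMonoid)
import Algebra.Definitions.RawMonoid as RawMonoidOps
open import Data.Fin.Base using (Fin)
open import Data.Fin.Properties using (all?; _≟_)
open import Data.Fin.Subset using (Subset; _∈_; _⊆_; ⁅_⁆; _∪_; ∣_∣; inside; outside)
open import Data.Fin.Subset.Properties
  using (_∈?_; _⊆?_; x∈⁅x⁆; x∈⁅y⁆⇒x≡y; ∣⁅x⁆∣≡1; p⊆p∪q)
import Data.Integer.Base as ℤ
import Data.Integer.Properties as ℤ
open import Data.List.Base using (List; []; _∷_; [_]; _++_; map; filter)
open import Data.List.Extrema.Nat using (max; v≤max⁺)
open import Data.List.Membership.Propositional renaming (_∈_ to _∈ₗ_)
open import Data.List.Membership.Propositional.Properties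
  using (∈-map⁺; ∈-++⁺ˡ; ∈-++⁺ʳ; ∈-filter⁺)
import Data.List.Relation.Unary.Any as Any
open import Data.Nat.Base as ℕ using (ℕ; zero; suc; NonZero)
import Data.Nat.Properties as ℕ
open import Data.Product.Base using (∃; ∃₂; Σ-syntax; _×_; _,_; proj₁)
open import Data.Rational.Base as ℚ using (ℚ; 0ℚ; 1ℚ; ½)
import Data.Rational.Properties as ℚ
import Data.Rational.Unnormalised.Base as ℚᵘ
import Data.Rational.Unnormalised.Properties as ℚᵘ
open import Data.Rational.Solver using (module +-*-Solver)
open import Data.Sum.Base using (_⊎_; inj₁; inj₂; [_,_]′)
open import Data.Vec.Base using ([]; _∷_; here; there)
open import Function.Bundles using (_⇔_; mk⇔; module Equivalence)
open import Relation.Binary.Core using (Rel)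
open import Relation.Binary.Definitions using (Decidable; Irreflexive; Symmetric)
open import Relation.Binary.PropositionalEquality
  using (_≡_; _≢_; refl; sym; trans; cong; subst; subst₂)
open import Relation.Nullary using (¬_; Dec; yes; no; contradiction)
open import Relation.Nullary.Decidable using (_×-dec_; _→-dec_; ¬?)
open import Relation.Unary using (Pred) renaming (Decidable to Decidable₁)

open +-*-Solver using (solve; _:+_; _:*_; :-_; _:=_; con)

p<q⇒0<q-p : ∀ {p q} → p ℚ.< q → 0ℚ ℚ.< q ℚ.- p
p<q⇒0<q-p {p} {q} p<q =
  subst (ℚ._< q ℚ.- p) (ℚ.+-inverseʳ p) (ℚ.+-monoˡ-< (ℚ.- p) p<q)

p-q<r⇒p<q+r : ∀ p q {r} → p ℚ.- q ℚ.< r → p ℚ.< q ℚ.+ r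
p-q<r⇒p<q+r p q {r} lt = subst (ℚ._< q ℚ.+ r)
  (solve 2 (λ p q → q :+ (p :+ :- q) := p) refl p q) (ℚ.+-monoʳ-< q lt)

p<r-q⇒q+p<r : ∀ {p} q r → p ℚ.< r ℚ.- q → q ℚ.+ p ℚ.< r
p<r-q⇒q+p<r {p} q r lt = subst (q ℚ.+ p ℚ.<_)
  (solve 2 (λ r q → q :+ (r :+ :- q) := r) refl r q) (ℚ.+-monoʳ-< q lt)

gap : ∀ p q r s → p ℚ.< r ℚ.- q → q ℚ.- s ℚ.< r ℚ.- (s ℚ.+ p)
gap p q r s lt = subst₂ ℚ._<_
  (solve 3 (λ p q s → p :+ (q :+ :- (s :+ p)) := q :+ :- s) refl p q s)
  (solve 4 (λ p q r s → (r :+ :- q) :+ (q :+ :- (s :+ p)) := r :+ :- (s :+ p)) refl p q r s)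
  (ℚ.+-monoˡ-< (q ℚ.- (s ℚ.+ p)) lt)

0<1 : 0ℚ ℚ.< 1ℚ
0<1 = ℚ.positive⁻¹ 1ℚ

p<p+q : ∀ p {q} → 0ℚ ℚ.< q → p ℚ.< p ℚ.+ q
p<p+q p {q} 0<q = subst (ℚ._< p ℚ.+ q) (ℚ.+-identityʳ p) (ℚ.+-monoʳ-< p 0<q)

p-1<p : ∀ p → p ℚ.- 1ℚ ℚ.< p
p-1<p p = subst (p ℚ.- 1ℚ ℚ.<_) (ℚ.+-identityʳ p)
  (ℚ.+-monoʳ-< p (ℚ.negative⁻¹ (ℚ.- 1ℚ)))

fromℕ : ℕ → ℚ
fromℕ zero    = 0ℚ
fromℕ (suc k) = 1ℚ ℚ.+ fromℕ k

toℚᵘ-fromℕ : ∀ k → ℚ.toℚᵘ (fromℕ k) ℚᵘ.≃ ℚᵘ.mkℚᵘ (ℤ.+ k) 0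
toℚᵘ-fromℕ zero    = ℚᵘ.≃-refl
toℚᵘ-fromℕ (suc k) = ℚᵘ.≃-trans (ℚ.toℚᵘ-homo-+ 1ℚ (fromℕ k))
  (ℚᵘ.≃-trans (ℚᵘ.+-congʳ (ℚᵘ.mkℚᵘ (ℤ.+ 1) 0) (toℚᵘ-fromℕ k))
    (ℚᵘ.*≡* (cong (ℤ._* ℤ.+ 1) (cong (λ i → ℤ.+ 1 ℤ.+ i) (ℤ.*-identityʳ (ℤ.+ k))))))

i<1+∣i∣ : ∀ i → i ℤ.< ℤ.+ suc ℤ.∣ i ∣
i<1+∣i∣ (ℤ.+ n)      = ℤ.+<+ (ℕ.n<1+n n)
i<1+∣i∣ (ℤ.-[1+ n ]) = ℤ.-<+

p<fromℕ : ∀ p → ∃ λ k → p ℚ.< fromℕ k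
p<fromℕ p@(ℚ.mkℚ _ _ _) = k , ℚ.toℚᵘ-cancel-< (ℚᵘ.<-respʳ-≃ (ℚᵘ.≃-sym (toℚᵘ-fromℕ k)) (ℚᵘ.*<* lt))
  where
  k = suc ℤ.∣ ℚ.↥ p ∣
  lt : ℚ.↥ p ℤ.* ℤ.+ 1 ℤ.< ℤ.+ k ℤ.* ℚ.↧ p
  lt = ℤ.<-≤-trans
    (subst (ℤ._< ℤ.+ k) (sym (ℤ.*-identityʳ (ℚ.↥ p))) (i<1+∣i∣ (ℚ.↥ p)))
    (subst (ℤ.+ k ℤ.≤_) (ℤ.pos-* k (ℚ.↧ₙ p)) (ℤ.+≤+ (ℕ.m≤m*n k (ℚ.↧ₙ p))))

module _ {q} (0<q : 0ℚ ℚ.< q) where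

  recipℚ : ℚ
  recipℚ = ℚ.1/_ q {{ℚ.>-nonZero 0<q}}

  0<recipℚ : 0ℚ ℚ.< recipℚ
  0<recipℚ = ℚ.positive⁻¹ recipℚ {{ℚ.1/pos⇒pos q {{ℚ.positive 0<q}}}}

  *-recipℚ : q ℚ.* recipℚ ≡ 1ℚ
  *-recipℚ = ℚ.*-inverseʳ q {{ℚ.>-nonZero 0<q}}

  *-mono-< : ∀ {p r} → p ℚ.< r → q ℚ.* p ℚ.< q ℚ.* r
  *-mono-< = ℚ.*-monoʳ-<-pos q {{ℚ.positive 0<q}}

  *-cancel-< : ∀ {p r} → q ℚ.* p ℚ.< q ℚ.* r → p ℚ.< r
  *-cancel-< = ℚ.*-cancelˡ-<-nonNeg q {{ℚ.pos⇒nonNeg q {{ℚ.positive 0<q}}}}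

  *-recipℚ-cancel : ∀ p → q ℚ.* (p ℚ.* recipℚ) ≡ p
  *-recipℚ-cancel p = trans
    (solve 3 (λ a b c → a :* (b :* c) := b :* (a :* c)) refl q p recipℚ)
    (trans (cong (p ℚ.*_) *-recipℚ) (ℚ.*-identityʳ p))

*-monoˡ-< : ∀ {p q r} → 0ℚ ℚ.< q → p ℚ.< r → p ℚ.* q ℚ.< r ℚ.* q
*-monoˡ-< {q = q} 0<q = ℚ.*-monoˡ-<-pos q {{ℚ.positive 0<q}}

*-nonpos : ∀ {q p} → 0ℚ ℚ.< q → p ℚ.≤ 0ℚ → q ℚ.* p ℚ.≤ 0ℚ
*-nonpos {q} {p} 0<q p≤0 = subst (q ℚ.* p ℚ.≤_) (ℚ.*-zeroʳ q)
  (ℚ.*-monoˡ-≤-nonNeg q {{ℚ.pos⇒nonNeg q {{ℚ.positive 0<q}}}} p≤0)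

0<factor : ∀ {q p} → 0ℚ ℚ.< q → 0ℚ ℚ.< q ℚ.* p → 0ℚ ℚ.< p
0<factor {q} {p} 0<q 0<qp = *-cancel-< 0<q (subst (ℚ._< q ℚ.* p) (sym (ℚ.*-zeroʳ q)) 0<qp)

<-*-dense : ∀ {q p t} → 0ℚ ℚ.< q → q ℚ.* p ℚ.< t → ∃ λ s → p ℚ.< s × q ℚ.* s ℚ.< t
<-*-dense {q} {p} {t} 0<q qp<t = divide (ℚ.<-dense qp<t)
  where
  divide : (∃ λ s → q ℚ.* p ℚ.< s × s ℚ.< t) → ∃ λ s → p ℚ.< s × q ℚ.* s ℚ.< t
  divide (s , qp<s , s<t) = s ℚ.* recipℚ 0<q
    , *-cancel-< 0<q (subst (q ℚ.* p ℚ.<_) (sym (*-recipℚ-cancel 0<q s)) qp<s)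
    , subst (ℚ._< t) (sym (*-recipℚ-cancel 0<q s)) s<t

*-<-dense : ∀ {q p t} → 0ℚ ℚ.< q → t ℚ.< q ℚ.* p → ∃ λ s → s ℚ.< p × t ℚ.< q ℚ.* s
*-<-dense {q} {p} {t} 0<q t<qp = divide (ℚ.<-dense t<qp)
  where
  divide : (∃ λ s → t ℚ.< s × s ℚ.< q ℚ.* p) → ∃ λ s → s ℚ.< p × t ℚ.< q ℚ.* s
  divide (s , t<s , s<qp) = s ℚ.* recipℚ 0<q
    , *-cancel-< 0<q (subst (ℚ._< q ℚ.* p) (sym (*-recipℚ-cancel 0<q s)) s<qp)
    , subst (t ℚ.<_) (sym (*-recipℚ-cancel 0<q s)) t<s

recipℚ-anti : ∀ {q r} (0<q : 0ℚ ℚ.< q) (0<r : 0ℚ ℚ.< r) → q ℚ.< r → recipℚ 0<r ℚ.< recipℚ 0<q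
recipℚ-anti {q} {r} 0<q 0<r q<r = *-cancel-< 0<q (*-cancel-< 0<r
  (subst₂ ℚ._<_
    (sym (*-recipℚ-cancel 0<r q))
    (sym (trans (cong (r ℚ.*_) (*-recipℚ 0<q)) (ℚ.*-identityʳ r)))
    q<r))

halve : ∀ {q} → 0ℚ ℚ.< q → ∃ λ p → 0ℚ ℚ.< p × p ℚ.+ p ≡ q
halve {q} 0<q = ½ ℚ.* q
  , ℚ.positive⁻¹ (½ ℚ.* q) {{ℚ.pos*pos⇒pos ½ q {{ℚ.positive 0<q}}}}
  , trans (sym (ℚ.*-distribʳ-+ q ½ ½)) (ℚ.*-identityˡ q)

archimedean : ∀ p {q} → 0ℚ ℚ.< q → ∃ λ k → p ℚ.< q ℚ.* fromℕ k
archimedean p {q} 0<q with p<fromℕ (p ℚ.* recipℚ 0<q)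
... | k , lt = k , subst (ℚ._< q ℚ.* fromℕ k) (*-recipℚ-cancel 0<q p) (*-mono-< 0<q lt)

-- Real numbers as two-sided Dedekind cuts of ℚ.
record ℝ : Set₁ where
  field
    Lower : Pred ℚ 0ℓ
    Upper : Pred ℚ 0ℓ
    lower-inhabited : ∃ Lower
    upper-inhabited : ∃ Upper
    lower-rounded : ∀ q → Lower q ⇔ (∃ λ r → q ℚ.< r × Lower r)
    upper-rounded : ∀ q → Upper q ⇔ (∃ λ r → r ℚ.< q × Upper r)
    disjoint : ∀ q → ¬ (Lower q × Upper q)
    located : ∀ {q r} → q ℚ.< r → Lower q ⊎ Upper r

open ℝ

lower-open : ∀ x {q} → Lower x q → ∃ λ r → q ℚ.< r × Lower x r
lower-open x {q} = Equivalence.to (lower-rounded x q)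

lower-down : ∀ x {q r} → q ℚ.< r → Lower x r → Lower x q
lower-down x {q} {r} q<r r∈L = Equivalence.from (lower-rounded x q) (r , q<r , r∈L)

upper-open : ∀ x {q} → Upper x q → ∃ λ r → r ℚ.< q × Upper x r
upper-open x {q} = Equivalence.to (upper-rounded x q)

upper-up : ∀ x {q r} → r ℚ.< q → Upper x r → Upper x q
upper-up x {q} {r} r<q r∈U = Equivalence.from (upper-rounded x q) (r , r<q , r∈U)

lower<upper : ∀ x {q r} → Lower x q → Upper x r → q ℚ.< r
lower<upper x {q} {r} q∈L r∈U with q ℚ.<? r
... | yes q<r = q<r
... | no q≮r with upper-open x r∈U
...   | s , s<r , s∈U = contradiction
  (lower-down x (ℚ.<-≤-trans s<r (ℚ.≮⇒≥ q≮r)) q∈L , s∈U) (disjoint x s)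

-- Walk up from a lower bound in steps of d = e / 2.
approximate : ∀ x {e} → 0ℚ ℚ.< e → ∃ λ a → Lower x a × Upper x (a ℚ.+ e)
approximate x {e} 0<e = start (halve 0<e) (lower-inhabited x) (upper-inhabited x)
  where
  walk : ∀ {d} → 0ℚ ℚ.< d → d ℚ.+ d ≡ e → ∀ k a → Lower x a →
         Upper x (a ℚ.+ d ℚ.* fromℕ k) → ∃ λ a → Lower x a × Upper x (a ℚ.+ e)
  walk {d} 0<d d+d≡e zero a a∈L u = contradiction
    (a∈L , subst (Upper x) (trans (cong (a ℚ.+_) (ℚ.*-zeroʳ d)) (ℚ.+-identityʳ a)) u)
    (disjoint x a)
  walk {d} 0<d d+d≡e (suc k) a a∈L u =
    [ (λ a+d∈L → walk 0<d d+d≡e k (a ℚ.+ d) a+d∈L (subst (Upper x)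
        (solve 3 (λ a d k → a :+ d :* (con 1ℚ :+ k) := (a :+ d) :+ d :* k) refl a d (fromℕ k)) u))
    , (λ a+2d∈U → a , a∈L , subst (λ s → Upper x (a ℚ.+ s)) d+d≡e a+2d∈U)
    ]′ (located x {a ℚ.+ d} {a ℚ.+ (d ℚ.+ d)} (ℚ.+-monoʳ-< a (p<p+q d 0<d)))

  start : (∃ λ d → 0ℚ ℚ.< d × d ℚ.+ d ≡ e) → ∃ (Lower x) → ∃ (Upper x) →
          ∃ λ a → Lower x a × Upper x (a ℚ.+ e)
  start (d , 0<d , d+d≡e) (a , a∈L) (b , b∈U) = run (archimedean (b ℚ.- a) 0<d)
    where
    run : (∃ λ k → b ℚ.- a ℚ.< d ℚ.* fromℕ k) → ∃ λ a → Lower x a × Upper x (a ℚ.+ e)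
    run (k , lt) = walk 0<d d+d≡e k a a∈L (upper-up x (p-q<r⇒p<q+r b a lt) b∈U)

infix 4 _<_ _≤_ _≈_

_<_ : Rel ℝ 0ℓ
x < y = ∃ λ q → Upper x q × Lower y q

_≤_ : Rel ℝ 0ℓ
x ≤ y = ∀ q → Lower x q → Lower y q

_≈_ : Rel ℝ 0ℓ
x ≈ y = x ≤ y × y ≤ x

fromℚ : ℚ → ℝ
fromℚ p = record
  { Lower = ℚ._< p
  ; Upper = p ℚ.<_
  ; lower-inhabited = p ℚ.- 1ℚ , p-1<p p
  ; upper-inhabited = p ℚ.+ 1ℚ , p<p+q p 0<1
  ; lower-rounded = λ q → mk⇔ ℚ.<-dense (λ (_ , q<r , r<p) → ℚ.<-trans q<r r<p)
  ; upper-rounded = λ q → mk⇔ (λ p<q → let r , p<r , r<q = ℚ.<-dense p<q in r , r<q , p<r)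
                              (λ (_ , r<q , p<r) → ℚ.<-trans p<r r<q)
  ; disjoint = λ q (q<p , p<q) → ℚ.<-asym q<p p<q
  ; located = loc
  }
  where
  loc : ∀ {q r} → q ℚ.< r → q ℚ.< p ⊎ p ℚ.< r
  loc {q} {r} q<r with q ℚ.<? p
  ... | yes q<p = inj₁ q<p
  ... | no q≮p = inj₂ (ℚ.≤-<-trans (ℚ.≮⇒≥ q≮p) q<r)

0ℝ 1ℝ : ℝ
0ℝ = fromℚ 0ℚ
1ℝ = fromℚ 1ℚ

infixl 6 _+_

_+_ : ℝ → ℝ → ℝ
x + y = record
  { Lower = λ q → ∃₂ λ a b → Lower x a × Lower y b × q ℚ.< a ℚ.+ b
  ; Upper = λ q → ∃₂ λ a b → Upper x a × Upper y b × a ℚ.+ b ℚ.< q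
  ; lower-inhabited =
      let a , a∈L = lower-inhabited x
          b , b∈L = lower-inhabited y
      in a ℚ.+ b ℚ.- 1ℚ , a , b , a∈L , b∈L , p-1<p (a ℚ.+ b)
  ; upper-inhabited =
      let a , a∈U = upper-inhabited x
          b , b∈U = upper-inhabited y
      in a ℚ.+ b ℚ.+ 1ℚ , a , b , a∈U , b∈U , p<p+q (a ℚ.+ b) 0<1
  ; lower-rounded = λ q → mk⇔
      (λ (a , b , a∈L , b∈L , q<) → let r , q<r , r< = ℚ.<-dense q< in
        r , q<r , a , b , a∈L , b∈L , r<)
      (λ (r , q<r , a , b , a∈L , b∈L , r<) → a , b , a∈L , b∈L , ℚ.<-trans q<r r<)
  ; upper-rounded = λ q → mk⇔
      (λ (a , b , a∈U , b∈U , <q) → let r , <r , r<q = ℚ.<-dense <q in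
        r , r<q , a , b , a∈U , b∈U , <r)
      (λ (r , r<q , a , b , a∈U , b∈U , <r) → a , b , a∈U , b∈U , ℚ.<-trans <r r<q)
  ; disjoint = λ q ((a , b , a∈L , b∈L , q<) , (a′ , b′ , a′∈U , b′∈U , <q)) →
      ℚ.<-asym (ℚ.<-trans q< (ℚ.+-mono-< (lower<upper x a∈L a′∈U) (lower<upper y b∈L b′∈U))) <q
  ; located = loc
  }
  where
  loc : ∀ {q r} → q ℚ.< r →
        (∃₂ λ a b → Lower x a × Lower y b × q ℚ.< a ℚ.+ b) ⊎
        (∃₂ λ a b → Upper x a × Upper y b × a ℚ.+ b ℚ.< r)
  loc {q} {r} q<r = gap′ (ℚ.<-dense {0ℚ} {r ℚ.- q} (p<q⇒0<q-p {q} {r} q<r))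
    where
    below : ∀ a → Lower x a → (∃ λ b → q ℚ.- a ℚ.< b × Lower y b) →
            ∃₂ λ a b → Lower x a × Lower y b × q ℚ.< a ℚ.+ b
    below a a∈L (b , q-a<b , b∈L) = a , b , a∈L , b∈L , p-q<r⇒p<q+r q a q-a<b

    above : ∀ a → Upper x a → (∃ λ b → b ℚ.< r ℚ.- a × Upper y b) →
            ∃₂ λ a b → Upper x a × Upper y b × a ℚ.+ b ℚ.< r
    above a a∈U (b , b<r-a , b∈U) = a , b , a∈U , b∈U , p<r-q⇒q+p<r a r b<r-a

    split : ∀ e → e ℚ.< r ℚ.- q → (∃ λ a → Lower x a × Upper x (a ℚ.+ e)) → _
    split e e<r-q (a , a∈L , a+e∈U) =
      [ (λ q-a∈L → inj₁ (below a a∈L (lower-open y q-a∈L)))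
      , (λ r-a-e∈U → inj₂ (above (a ℚ.+ e) a+e∈U (upper-open y r-a-e∈U)))
      ]′ (located y {q ℚ.- a} {r ℚ.- (a ℚ.+ e)} (gap e q r a e<r-q))

    gap′ : (∃ λ e → 0ℚ ℚ.< e × e ℚ.< r ℚ.- q) → _
    gap′ (e , 0<e , e<r-q) = split e e<r-q (approximate x 0<e)

+-rawMonoid : RawMonoid (lsuc 0ℓ) 0ℓ
+-rawMonoid = record { Carrier = ℝ ; _≈_ = _≈_ ; _∙_ = _+_ ; ε = 0ℝ }

infixr 8 _·_

-- n · x = x + ⋯ + x, the product of the natural number n with x
_·_ : ℕ → ℝ → ℝ
_·_ = RawMonoidOps._×_ +-rawMonoid

-- For x > 0:  q < 1/x  iff  r * q < 1 for some rational r > x,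
-- and  q > 1/x  iff  r * q > 1 for some rational r with 0 < r < x.
recip : (x : ℝ) → 0ℝ < x → ℝ
recip x (p , 0<p , p∈L) = record
  { Lower = Lo
  ; Upper = Up
  ; lower-inhabited = lo-inhabited (upper-inhabited x)
  ; upper-inhabited = recipℚ 0<p ℚ.+ 1ℚ , p , p∈L , 0<p ,
      subst (ℚ._< p ℚ.* (recipℚ 0<p ℚ.+ 1ℚ)) (*-recipℚ 0<p)
        (*-mono-< 0<p (p<p+q (recipℚ 0<p) 0<1))
  ; lower-rounded = λ q → mk⇔
      (λ (r , r∈U , rq<1) → lo-open q r r∈U (<-*-dense (0<upper r∈U) rq<1))
      (λ (s , q<s , r , r∈U , rs<1) → r , r∈U , ℚ.<-trans (*-mono-< (0<upper r∈U) q<s) rs<1)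
  ; upper-rounded = λ q → mk⇔
      (λ (r , r∈L , 0<r , 1<rq) → up-open q r r∈L 0<r (*-<-dense 0<r 1<rq))
      (λ (s , s<q , r , r∈L , 0<r , 1<rs) → r , r∈L , 0<r , ℚ.<-trans 1<rs (*-mono-< 0<r s<q))
  ; disjoint = λ q ((r , r∈U , rq<1) , (r′ , r′∈L , 0<r′ , 1<r′q)) →
      ℚ.<-asym (ℚ.<-trans 1<r′q
        (*-monoˡ-< (0<factor 0<r′ (ℚ.<-trans 0<1 1<r′q)) (lower<upper x r′∈L r∈U))) rq<1
  ; located = loc
  }
  where
  Lo Up : Pred ℚ 0ℓ
  Lo q = ∃ λ r → Upper x r × r ℚ.* q ℚ.< 1ℚ
  Up q = ∃ λ r → Lower x r × 0ℚ ℚ.< r × 1ℚ ℚ.< r ℚ.* q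

  0<upper : ∀ {r} → Upper x r → 0ℚ ℚ.< r
  0<upper r∈U = ℚ.<-trans 0<p (lower<upper x p∈L r∈U)

  lo-inhabited : ∃ (Upper x) → ∃ Lo
  lo-inhabited (b , b∈U) = 0ℚ , b , b∈U , subst (ℚ._< 1ℚ) (sym (ℚ.*-zeroʳ b)) 0<1

  lo-open : ∀ q r → Upper x r → (∃ λ s → q ℚ.< s × r ℚ.* s ℚ.< 1ℚ) →
            ∃ λ s → q ℚ.< s × Lo s
  lo-open q r r∈U (s , q<s , rs<1) = s , q<s , r , r∈U , rs<1

  up-open : ∀ q r → Lower x r → 0ℚ ℚ.< r → (∃ λ s → s ℚ.< q × 1ℚ ℚ.< r ℚ.* s) →
            ∃ λ s → s ℚ.< q × Up s
  up-open q r r∈L 0<r (s , s<q , 1<rs) = s , s<q , r , r∈L , 0<r , 1<rs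

  nonpos : ∀ {q} → q ℚ.≤ 0ℚ → ∃ (Upper x) → Lo q
  nonpos q≤0 (b , b∈U) = b , b∈U , ℚ.≤-<-trans (*-nonpos (0<upper b∈U) q≤0) 0<1

  module _ {q r} (0<q : 0ℚ ℚ.< q) (q<r : q ℚ.< r) where

    0<r : 0ℚ ℚ.< r
    0<r = ℚ.<-trans 0<q q<r

    up : (∃ λ s → recipℚ 0<r ℚ.< s × Lower x s) → Up r
    up (s , 1/r<s , s∈L) = s , s∈L , ℚ.<-trans (0<recipℚ 0<r) 1/r<s ,
      subst (ℚ._< s ℚ.* r) (trans (ℚ.*-comm (recipℚ 0<r) r) (*-recipℚ 0<r)) (*-monoˡ-< 0<r 1/r<s)

    lo : (∃ λ s → s ℚ.< recipℚ 0<q × Upper x s) → Lo q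
    lo (s , s<1/q , s∈U) = s , s∈U ,
      subst (s ℚ.* q ℚ.<_) (trans (ℚ.*-comm (recipℚ 0<q) q) (*-recipℚ 0<q)) (*-monoˡ-< 0<q s<1/q)

  loc : ∀ {q r} → q ℚ.< r → Lo q ⊎ Up r
  loc {q} {r} q<r = decide (0ℚ ℚ.<? q)
    where
    decide : Dec (0ℚ ℚ.< q) → Lo q ⊎ Up r
    decide (no 0≮q)  = inj₁ (nonpos (ℚ.≮⇒≥ 0≮q) (upper-inhabited x))
    decide (yes 0<q) =
      [ (λ 1/r∈L → inj₂ (up 0<q q<r (lower-open x 1/r∈L)))
      , (λ 1/q∈U → inj₁ (lo 0<q q<r (upper-open x 1/q∈U)))
      ]′ (located x (recipℚ-anti 0<q (0<r 0<q q<r) q<r))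

0<n·x : ∀ n {{_ : NonZero n}} x → 0ℝ < x → 0ℝ < n · x
0<n·x (suc zero) x (p , 0<p , p∈L) = one (lower-open x p∈L)
  where
  one : (∃ λ r → p ℚ.< r × Lower x r) → 0ℝ < 1 · x
  one (r , p<r , r∈L) = shift (ℚ.<-dense p<r)
    where
    shift : (∃ λ s → p ℚ.< s × s ℚ.< r) → 0ℝ < 1 · x
    shift (s , p<s , s<r) = p , 0<p , r , s ℚ.- r , r∈L
      , subst (s ℚ.- r ℚ.<_) (ℚ.+-inverseʳ r) (ℚ.+-monoˡ-< (ℚ.- r) s<r)
      , subst (p ℚ.<_) (solve 2 (λ r s → s := r :+ (s :+ :- r)) refl r s) p<s
0<n·x (suc (suc n)) x 0<x@(p , 0<p , p∈L) = two (0<n·x (suc n) x 0<x)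
  where
  two : 0ℝ < suc n · x → 0ℝ < suc (suc n) · x
  two (q , 0<q , q∈L) = p , 0<p , p , q , p∈L , q∈L , p<p+q p 0<q

record Graph (n : ℕ) : Set₁ where
  field
    Adj : Rel (Fin n) 0ℓ
    adj? : Decidable Adj
    adj-sym : Symmetric Adj
    adj-irrefl : Irreflexive _≡_ Adj

-- The induced subgraph G[S] is represented by its vertex set S : Subset n.

Vertex : ∀ {n} → Subset n → Set
Vertex S = ∃ (_∈ S)

∑ : ∀ {n} (S : Subset n) → (Vertex S → ℝ) → ℝ
∑ []            g = 0ℝ
∑ (inside ∷ S)  g = g (Fin.zero , here) + ∑ S (λ (v , v∈S) → g (Fin.suc v , there v∈S))
∑ (outside ∷ S) g = ∑ S (λ (v , v∈S) → g (Fin.suc v , there v∈S))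

extend : ∀ {n} {S : Subset n} (w : Fin n) → Vertex S → Vertex (S ∪ ⁅ w ⁆)
extend w (v , v∈S) = v , p⊆p∪q ⁅ w ⁆ v∈S

subsets : ∀ n → List (Subset n)
subsets zero    = [ [] ]
subsets (suc n) = map (inside ∷_) (subsets n) ++ map (outside ∷_) (subsets n)

∈-subsets : ∀ {n} (S : Subset n) → S ∈ₗ subsets n
∈-subsets []            = Any.here refl
∈-subsets (inside ∷ S)  = ∈-++⁺ˡ (∈-map⁺ (inside ∷_) (∈-subsets S))
∈-subsets (outside ∷ S) = ∈-++⁺ʳ (map (inside ∷_) (subsets _)) (∈-map⁺ (outside ∷_) (∈-subsets S))

-- The largest size of a subset satisfying P (0 if there is none).
largest : ∀ {n} {P : Pred (Subset n) 0ℓ} → Decidable₁ P → ℕ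
largest {n} P? = max 0 (map ∣_∣ (filter P? (subsets n)))

∣S∣≤largest : ∀ {n} {P : Pred (Subset n) 0ℓ} (P? : Decidable₁ P) {S} → P S → ∣ S ∣ ℕ.≤ largest P?
∣S∣≤largest {n} P? {S} PS = v≤max⁺ 0 (map ∣_∣ (filter P? (subsets n)))
  (inj₂ (Any.map ℕ.≤-reflexive (∈-map⁺ ∣_∣ (∈-filter⁺ P? (∈-subsets S) PS))))

module _ {n} (G : Graph n) where
  open Graph G

  IsClique : Pred (Subset n) 0ℓ
  IsClique K = ∀ u v → u ∈ K → v ∈ K → u ≢ v → Adj u v

  isClique? : Decidable₁ IsClique
  isClique? K = all? λ u → all? λ v →
    (u ∈? K) →-dec ((v ∈? K) →-dec (¬? (u ≟ v) →-dec adj? u v))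

  IsIndependent : Pred (Subset n) 0ℓ
  IsIndependent S = ∀ u v → u ∈ S → v ∈ S → ¬ Adj u v

  cliqueNumber : Subset n → ℕ
  cliqueNumber S = largest (λ K → (K ⊆? S) ×-dec isClique? K)

  Colouring : Subset n → ℕ → Set
  Colouring S k =
    Σ[ colour ∈ (Vertex S → Fin k) ] (∀ u v → Adj (proj₁ u) (proj₁ v) → colour u ≢ colour v)

  IsChromaticNumber : Subset n → ℕ → Set
  IsChromaticNumber S k = Colouring S k × (∀ j → Colouring S j → k ℕ.≤ j)

  IsPerfect : Set
  IsPerfect = ∀ S → IsChromaticNumber S (cliqueNumber S)

  cliqueNumberAt : (S : Subset n) → Vertex S → ℕ
  cliqueNumberAt S (v , _) = largest (λ K → (K ⊆? S) ×-dec (isClique? K ×-dec (v ∈? K)))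

  cliqueNumberAt-nonZero : ∀ S v → NonZero (cliqueNumberAt S v)
  cliqueNumberAt-nonZero S (v , v∈S) = ℕ.>-nonZero (subst (ℕ._≤ cliqueNumberAt S (v , v∈S)) (∣⁅x⁆∣≡1 v)
    (∣S∣≤largest (λ K → (K ⊆? S) ×-dec (isClique? K ×-dec (v ∈? K)))
      ( (λ u∈ → subst (_∈ S) (sym (x∈⁅y⁆⇒x≡y v u∈)) v∈S)
      , (λ u w u∈ w∈ u≢w → contradiction (trans (x∈⁅y⁆⇒x≡y v u∈) (sym (x∈⁅y⁆⇒x≡y v w∈))) u≢w)
      , x∈⁅x⁆ v)))

  0<c·x : ∀ S v {x} → 0ℝ < x → 0ℝ < cliqueNumberAt S v · x
  0<c·x S v {x} 0<x = 0<n·x (cliqueNumberAt S v) {{cliqueNumberAt-nonZero S v}} x 0<x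

{-# OPTIONS --safe #-}

module Submission where

open import Defs
open import Algebra.Bundles using (CommutativeMonoid)
open import Data.Bool.Base using (true; false; if_then_else_)
open import Data.Fin.Base using (Fin; zero; suc)
open import Data.Fin.Properties using (any?; _≟_; suc-injective)
open import Data.Fin.Subset
  using (Subset; _∈_; _∉_; _⊆_; _⊃_; _∪_; _∩_; ⁅_⁆; ∣_∣; inside; outside)
open import Data.Fin.Subset.Induction using (⊃-wellFounded)
open import Data.Fin.Subset.Properties
  using ( _∈?_; _⊆?_; drop-there; x∈⁅y⁆⇒x≡y; x∈⁅x⁆; x∈p∪q⁻; p⊆p∪q; q⊆p∪q; p∩q⊆p; p∩q⊆q
        ; ⊆-antisym)
open import Data.List.Base using (List; []; _∷_; length; tabulate)
open import Data.List.Extrema.Nat using (max≤v⁺)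
open import Data.List.Properties using (length-tabulate)
open import Data.List.Relation.Unary.All as All using (All; []; _∷_)
import Data.List.Relation.Unary.All.Properties as All
open import Data.List.Relation.Unary.Any using (Any; here; there)
import Data.List.Relation.Unary.Any.Properties as Any
open import Data.Nat.Base as ℕ using (ℕ; zero; suc; z≤n; s≤s; NonZero)
open import Data.Nat.Induction using (<-wellFounded)
import Data.Nat.Properties as ℕ
open import Data.Product.Base using (∃; ∃₂; _×_; _,_; proj₁; proj₂)
open import Data.Rational.Base as ℚ using (0ℚ; 1ℚ)
import Data.Rational.Properties as ℚ
open import Data.Rational.Solver using (module +-*-Solver)
open import Data.Sum.Base using ([_,_]′)
open import Data.Vec.Base as Vec using ([]; _∷_; here; there; lookup)
open import Data.Vec.Functional using (updateAt)
open import Data.Vec.Functional.Properties using (updateAt-updates; updateAt-minimal)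
open import Data.Vec.Properties using ([]=⇒lookup; lookup⇒[]=; lookup∘tabulate)
open import Data.Vec.Properties.WithK using ([]=-irrelevant)
open import Function.Base using (_∘_; const; id)
open import Induction.WellFounded using (Acc; acc)
open import Level using (0ℓ) renaming (suc to lsuc)
open import Relation.Binary.Bundles using (Poset)
open import Relation.Binary.PropositionalEquality
  using (_≡_; _≢_; refl; sym; trans; cong; subst)
import Relation.Binary.Reasoning.PartialOrder as PosetReasoning
open import Relation.Binary.Structures using (IsEquivalence)
open import Relation.Nullary using (yes; no; does; contradiction)
open import Relation.Nullary.Decidable using (_×-dec_; ¬?; dec-true; decidable-stable)
open import Relation.Unary using (Pred) renaming (Decidable to Decidable₁)

open import Algebra.Properties.CommutativeSemigroup ℕ.+-commutativeSemigroup
  using () renaming (interchange to ℕ-+-interchange; x∙yz≈y∙xz to m+[n+o]≡n+[m+o])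
open import Algebra.Properties.CommutativeSemigroup ℕ.*-commutativeSemigroup
  using () renaming (xy∙z≈xz∙y to m*n*o≡m*o*n)

-- A clique K of G[S] satisfies ∑_{v ∈ K} 1/c(v) ≤ 1, and since G is perfect such weights are
-- dominated by a convex combination of indicators of independent sets (proved by replication).
-- Cleared of denominators: for a common multiple N of the c(v) there are N independent sets
-- covering every v ∈ S at least N/c(v) times.  Hence N · ∑ 1/(f(S,v) c(v)) is at most the sum over
-- these sets I of ∑_{v ∈ S ∩ I} 1/f(S,v) ≤ ∑_{v ∈ S ∩ I} 1/f(S ∩ I,v) ≤ 1, that is, at most N.

open ℝ

-- Natural-number weights of vertex sets

weight : ∀ {n} → Subset n → (Fin n → ℕ) → ℕ
weight []            w = 0
weight (inside ∷ K)  w = w zero ℕ.+ weight K (w ∘ suc)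
weight (outside ∷ K) w = weight K (w ∘ suc)

weight-mono-≤ : ∀ {n} (K : Subset n) {w w′ : Fin n → ℕ} →
                (∀ {v} → v ∈ K → w v ℕ.≤ w′ v) → weight K w ℕ.≤ weight K w′
weight-mono-≤ []            w≤ = z≤n
weight-mono-≤ (inside ∷ K)  w≤ = ℕ.+-mono-≤ (w≤ here) (weight-mono-≤ K (w≤ ∘ there))
weight-mono-≤ (outside ∷ K) w≤ = weight-mono-≤ K (w≤ ∘ there)

weight-mono-< : ∀ {n} (K : Subset n) {w w′ : Fin n → ℕ} {x} → x ∈ K →
                (∀ v → w v ℕ.≤ w′ v) → w x ℕ.< w′ x → weight K w ℕ.< weight K w′
weight-mono-< (inside ∷ K)  here        w≤ w< =
  ℕ.+-mono-<-≤ w< (weight-mono-≤ K λ {v} _ → w≤ (suc v))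
weight-mono-< (inside ∷ K)  (there x∈K) w≤ w< =
  ℕ.+-mono-≤-< (w≤ zero) (weight-mono-< K x∈K (w≤ ∘ suc) w<)
weight-mono-< (outside ∷ K) (there x∈K) w≤ w< = weight-mono-< K x∈K (w≤ ∘ suc) w<

weight-+ : ∀ {n} (K : Subset n) (w w′ : Fin n → ℕ) →
           weight K (λ v → w v ℕ.+ w′ v) ≡ weight K w ℕ.+ weight K w′
weight-+ []            w w′ = refl
weight-+ (inside ∷ K)  w w′ = trans
  (cong (w zero ℕ.+ w′ zero ℕ.+_) (weight-+ K (w ∘ suc) (w′ ∘ suc)))
  (ℕ-+-interchange (w zero) (w′ zero) _ _)
weight-+ (outside ∷ K) w w′ = weight-+ K (w ∘ suc) (w′ ∘ suc)

weight-const : ∀ {n} (K : Subset n) c → weight K (const c) ≡ ∣ K ∣ ℕ.* c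
weight-const []            c = refl
weight-const (inside ∷ K)  c = cong (c ℕ.+_) (weight-const K c)
weight-const (outside ∷ K) c = weight-const K c

weight-* : ∀ {n} (K : Subset n) (w : Fin n → ℕ) c →
           weight K (λ v → w v ℕ.* c) ≡ weight K w ℕ.* c
weight-* []            w c = refl
weight-* (inside ∷ K)  w c = trans (cong (w zero ℕ.* c ℕ.+_) (weight-* K (w ∘ suc) c))
  (sym (ℕ.*-distribʳ-+ c (w zero) _))
weight-* (outside ∷ K) w c = weight-* K (w ∘ suc) c

indicator : ∀ {n} → Subset n → Fin n → ℕ
indicator I v = if lookup I v then 1 else 0

∈⇒indicator≡1 : ∀ {n} {I : Subset n} {v} → v ∈ I → indicator I v ≡ 1
∈⇒indicator≡1 v∈I = cong (if_then 1 else 0) ([]=⇒lookup v∈I)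

∉⇒indicator≡0 : ∀ {n} {I : Subset n} {v} → v ∉ I → indicator I v ≡ 0
∉⇒indicator≡0 {I = I} {v} v∉I with lookup I v in eq
... | true  = contradiction (lookup⇒[]= v I eq) v∉I
... | false = refl

weight-indicator : ∀ {n} (K I : Subset n) → weight K (indicator I) ≡ ∣ K ∩ I ∣
weight-indicator []            []            = refl
weight-indicator (inside ∷ K)  (inside ∷ I)  = cong suc (weight-indicator K I)
weight-indicator (inside ∷ K)  (outside ∷ I) = weight-indicator K I
weight-indicator (outside ∷ K) (i ∷ I)       = weight-indicator K I

∣S∣≡0 : ∀ {n} (S : Subset n) → (∀ v → v ∉ S) → ∣ S ∣ ≡ 0
∣S∣≡0 []            _ = refl
∣S∣≡0 (inside ∷ S)  ∉ = contradiction here (∉ zero)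
∣S∣≡0 (outside ∷ S) ∉ = ∣S∣≡0 S λ v → ∉ (suc v) ∘ there

∣S∣≤1 : ∀ {n} (S : Subset n) → (∀ {u v} → u ∈ S → v ∈ S → u ≡ v) → ∣ S ∣ ℕ.≤ 1
∣S∣≤1 []            _ = z≤n
∣S∣≤1 (inside ∷ S)  ≡ = s≤s (ℕ.≤-reflexive
  (∣S∣≡0 S λ v v∈S → contradiction (≡ here (there v∈S)) λ ()))
∣S∣≤1 (outside ∷ S) ≡ = ∣S∣≤1 S λ u∈S v∈S → suc-injective (≡ (there u∈S) (there v∈S))

∣S∣≢0 : ∀ {n} {S : Subset n} {v} → v ∈ S → NonZero ∣ S ∣
∣S∣≢0 {S = inside ∷ S}  here        = _
∣S∣≢0 {S = inside ∷ S}  (there v∈S) = _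
∣S∣≢0 {S = outside ∷ S} (there v∈S) = ∣S∣≢0 v∈S

-- Scaled by `∣ K ∣`, the weight becomes a sum of `∣ K ∣` terms, each at most `N`; then `∣ K ∣` is
-- cancelled, so the empty set is treated apart. In this form a clique `K` meets the bound ∑ 1/c(v)
-- ≤ 1 with denominators cleared.
weight≤ : ∀ {n} (K : Subset n) {w : Fin n → ℕ} {N} →
          (∀ {v} → v ∈ K → w v ℕ.* ∣ K ∣ ℕ.≤ N) → weight K w ℕ.≤ N
weight≤ K {w} {N} w∣K∣≤N with ∣ K ∣ ℕ.≟ 0
... | yes ∣K∣≡0 = ℕ.≤-trans (weight-mono-≤ K {w′ = const 0}
    λ v∈K → contradiction ∣K∣≡0 (ℕ.≢-nonZero⁻¹ _ {{∣S∣≢0 v∈K}}))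
  (ℕ.≤-trans (ℕ.≤-reflexive (trans (weight-const K 0) (ℕ.*-zeroʳ ∣ K ∣))) z≤n)
... | no ∣K∣≢0 = ℕ.*-cancelʳ-≤ (weight K w) N ∣ K ∣ {{ℕ.≢-nonZero ∣K∣≢0}} (begin
    weight K w ℕ.* ∣ K ∣             ≡⟨ weight-* K w ∣ K ∣ ⟨
    weight K (λ v → w v ℕ.* ∣ K ∣)  ≤⟨ weight-mono-≤ K w∣K∣≤N ⟩
    weight K (const N)              ≡⟨ weight-const K N ⟩
    ∣ K ∣ ℕ.* N                      ≡⟨ ℕ.*-comm ∣ K ∣ N ⟩
    N ℕ.* ∣ K ∣                      ∎)
  where open ℕ.≤-Reasoning

-- Subsets cut out by decidable predicates

comprehension : ∀ {n} {P : Pred (Fin n) 0ℓ} → Decidable₁ P → Subset n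
comprehension P? = Vec.tabulate (does ∘ P?)

module _ {n} {P : Pred (Fin n) 0ℓ} (P? : Decidable₁ P) where

  ∈-comprehension⁺ : ∀ {v} → P v → v ∈ comprehension P?
  ∈-comprehension⁺ {v} Pv = lookup⇒[]= v _
    (trans (lookup∘tabulate (does ∘ P?) v) (dec-true (P? v) Pv))

  ∈-comprehension⁻ : ∀ {v} → v ∈ comprehension P? → P v
  ∈-comprehension⁻ {v} v∈ with P? v in eq
  ... | yes Pv = Pv
  ... | no ¬Pv = contradiction
    (trans (sym ([]=⇒lookup v∈)) (trans (lookup∘tabulate (does ∘ P?) v) (cong does eq))) λ ()

-- Families of sets and their coverage

coverage : ∀ {n} → List (Subset n) → Fin n → ℕ
coverage []       v = 0
coverage (I ∷ Is) v = indicator I v ℕ.+ coverage Is v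

Any⇒1≤coverage : ∀ {n} {Is : List (Subset n)} {v} → Any (v ∈_) Is → 1 ℕ.≤ coverage Is v
Any⇒1≤coverage (here v∈I) =
  ℕ.≤-trans (ℕ.≤-reflexive (sym (∈⇒indicator≡1 v∈I))) (ℕ.m≤m+n _ _)
Any⇒1≤coverage {Is = I ∷ _} (there v∈Is) =
  ℕ.≤-trans (Any⇒1≤coverage v∈Is) (ℕ.m≤n+m _ (indicator I _))

-- A list of classes matters only through its length and its coverage, so the position from which
-- `removed` is taken is not recorded.
record Removal {n} (P : Pred (Subset n) 0ℓ) (Is : List (Subset n)) (v : Fin n) : Set where
  field
    removed   : Subset n
    rest      : List (Subset n)
    v∈        : v ∈ removed
    P-removed : P removed
    P-rest    : All P rest
    length≡   : length Is ≡ suc (length rest)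
    coverage≡ : ∀ u → coverage Is u ≡ indicator removed u ℕ.+ coverage rest u

remove : ∀ {n} {P : Pred (Subset n) 0ℓ} {Is v} → All P Is → 1 ℕ.≤ coverage Is v → Removal P Is v
remove {Is = I ∷ Is} {v} (PI ∷ PIs) 1≤ with lookup I v in eq
... | true  = record
  { v∈ = lookup⇒[]= v I eq ; P-removed = PI ; P-rest = PIs ; length≡ = refl ; coverage≡ = λ _ → refl }
-- The indicator of `I` at `v` has reduced to 0 in the type of `1≤`, which therefore already bounds
-- the coverage by `Is`.
... | false = record
  { v∈ = R.v∈ ; P-removed = R.P-removed ; P-rest = PI ∷ R.P-rest ; length≡ = cong suc R.length≡
  ; coverage≡ = λ u → trans (cong (indicator I u ℕ.+_) (R.coverage≡ u))
      (m+[n+o]≡n+[m+o] (indicator I u) (indicator R.removed u) (coverage R.rest u))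
  }
  where
  module R = Removal (remove PIs 1≤)

largest≤ : ∀ {n} {P : Pred (Subset n) 0ℓ} (P? : Decidable₁ P) {k} →
           (∀ {S} → P S → ∣ S ∣ ℕ.≤ k) → largest P? ℕ.≤ k
largest≤ P? ≤k = max≤v⁺ z≤n (All.map⁺ (All.map ≤k (All.all-filter P? (subsets _))))

-- Weighted colourings of perfect graphs

module _ {n} (G : Graph n) where

  independent-⊆ : ∀ {S T} → S ⊆ T → IsIndependent G T → IsIndependent G S
  independent-⊆ S⊆T ind u v u∈S v∈S = ind u v (S⊆T u∈S) (S⊆T v∈S)

  -- Two distinct common vertices would be adjacent in the clique and non-adjacent in the
  -- independent set.
  clique∩independent : ∀ {K I} → IsClique G K → IsIndependent G I → weight K (indicator I) ℕ.≤ 1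
  clique∩independent {K} {I} clique independent =
    subst (ℕ._≤ 1) (sym (weight-indicator K I)) (∣S∣≤1 (K ∩ I) same)
    where
    same : ∀ {u v} → u ∈ K ∩ I → v ∈ K ∩ I → u ≡ v
    same {u} {v} u∈ v∈ with u ≟ v
    ... | yes u≡v = u≡v
    ... | no  u≢v = contradiction (clique u v (p∩q⊆p K I u∈) (p∩q⊆p K I v∈) u≢v)
                      (independent u v (p∩q⊆q K I u∈) (p∩q⊆q K I v∈))

  weight-coverage≤length : ∀ {K Is} → IsClique G K → All (IsIndependent G) Is →
                           weight K (coverage Is) ℕ.≤ length Is
  weight-coverage≤length {K} clique [] = ℕ.≤-reflexive (trans (weight-const K 0) (ℕ.*-zeroʳ ∣ K ∣))
  weight-coverage≤length {K} {I ∷ Is} clique (indI ∷ indIs) =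
    subst (ℕ._≤ _) (sym (weight-+ K (indicator I) (coverage Is)))
      (ℕ.+-mono-≤ (clique∩independent clique indI) (weight-coverage≤length clique indIs))

  -- This amounts to a colouring with `k` colours of the graph obtained from G[S] by replacing each
  -- `v` with a clique of `w v` copies: a class is the set of vertices having a copy of that colour.
  -- Covering a vertex too often is allowed.
  record Cover (S : Subset n) (w : Fin n → ℕ) (k : ℕ) : Set where
    field
      classes     : List (Subset n)
      independent : All (IsIndependent G) classes
      length≤     : length classes ℕ.≤ k
      covers      : ∀ {v} → v ∈ S → w v ℕ.≤ coverage classes v

  -- In the replicated graph this says that the clique number is at most `k`.
  CliqueWeight≤ : Subset n → (Fin n → ℕ) → ℕ → Set
  CliqueWeight≤ S w k = ∀ K → K ⊆ S → IsClique G K → weight K w ℕ.≤ k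

  -- With weights 0 and 1 no vertex is replicated, so an optimal colouring of the support `T` is
  -- enough. Weights on `T` are at least 1, so a clique of `T` has at most as many vertices as its
  -- weight, and perfection gives at most `k` colours.
  colourCover : IsPerfect G → ∀ {S w k} → (∀ {v} → v ∈ S → w v ℕ.≤ 1) →
                CliqueWeight≤ S w k → Cover S w k
  colourCover perfect {S} {w} {k} w≤1 cliqueWeight≤k = record
    { classes = tabulate class
    ; independent = All.tabulate⁺ class-independent
    ; length≤ = subst (ℕ._≤ k) (sym (length-tabulate class)) ω≤k
    ; covers = covers
    }
    where
    support? : Decidable₁ (λ v → v ∈ S × 1 ℕ.≤ w v)
    support? v = (v ∈? S) ×-dec (1 ℕ.≤? w v)

    T = comprehension support?

    ω = cliqueNumber G T

    colouring : Colouring G T ω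
    colouring = proj₁ (perfect T)

    colour : Vertex T → Fin ω
    colour = proj₁ colouring

    HasColour : Fin ω → Pred (Fin n) 0ℓ
    HasColour i v = ∃ λ (v∈T : v ∈ T) → colour (v , v∈T) ≡ i

    hasColour? : ∀ i → Decidable₁ (HasColour i)
    hasColour? i v with v ∈? T
    ... | no v∉T = no (v∉T ∘ proj₁)
    ... | yes v∈T with colour (v , v∈T) ≟ i
    ...   | yes eq = yes (v∈T , eq)
    ...   | no neq = no λ (v∈T′ , eq) →
      neq (trans (cong (λ p → colour (v , p)) ([]=-irrelevant v∈T v∈T′)) eq)

    class : Fin ω → Subset n
    class i = comprehension (hasColour? i)

    class-independent : ∀ i → IsIndependent G (class i)
    class-independent i u v u∈ v∈ adj =
      let (u∈T , cu≡i) = ∈-comprehension⁻ (hasColour? i) u∈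
          (v∈T , cv≡i) = ∈-comprehension⁻ (hasColour? i) v∈
      in proj₂ colouring (u , u∈T) (v , v∈T) adj (trans cu≡i (sym cv≡i))

    ω≤k : ω ℕ.≤ k
    ω≤k = largest≤ (λ K → (K ⊆? T) ×-dec isClique? G K) λ {K} (K⊆T , clique) → begin
      ∣ K ∣                ≡⟨ ℕ.*-identityʳ ∣ K ∣ ⟨
      ∣ K ∣ ℕ.* 1          ≡⟨ weight-const K 1 ⟨
      weight K (const 1)  ≤⟨ weight-mono-≤ K (proj₂ ∘ ∈-comprehension⁻ support? ∘ K⊆T) ⟩
      weight K w          ≤⟨ cliqueWeight≤k K (proj₁ ∘ ∈-comprehension⁻ support? ∘ K⊆T) clique ⟩
      k                   ∎
      where open ℕ.≤-Reasoning

    covers : ∀ {v} → v ∈ S → w v ℕ.≤ coverage (tabulate class) v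
    covers {v} v∈S with 1 ℕ.≤? w v
    ... | no w≱1  = ℕ.≤-trans (ℕ.≤-pred (ℕ.≰⇒> w≱1)) z≤n
    ... | yes w≥1 = ℕ.≤-trans (w≤1 v∈S) (Any⇒1≤coverage (Any.tabulate⁺ (colour (v , v∈T))
                      (∈-comprehension⁺ (hasColour? _) (v∈T , refl))))
      where v∈T = ∈-comprehension⁺ support? (v∈S , w≥1)

  -- Lovász's replication argument.  If w x ≥ 2, cover w − 1_x first and let A be a class of that
  -- cover containing x.  For a clique K avoiding x the other classes bound the weight of w − 1_A
  -- by k − 1; for a clique through x subtracting 1_A loses at least one.  So w − 1_A has a cover
  -- by k − 1 classes, to which A is added.
  perfect⇒cover : IsPerfect G → ∀ {S w k} → CliqueWeight≤ S w k → Cover S w k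
  perfect⇒cover perfect {S} {w} = go w (<-wellFounded (weight S w))
    where
    -- The recursion is on the total weight over `S`: both `w₁` and `w₂` are smaller at `x`, which
    -- lies in `S`. The bound `k` stays quantified because the second call lowers it.
    go : ∀ w → Acc ℕ._<_ (weight S w) → ∀ {k} → CliqueWeight≤ S w k → Cover S w k
    go w (acc rec) {k} cliqueWeight≤k with any? (λ v → (v ∈? S) ×-dec (2 ℕ.≤? w v))
    ... | no small = colourCover perfect
            (λ {v} v∈S → ℕ.≤-pred (ℕ.≰⇒> λ w≥2 → small (v , v∈S , w≥2))) cliqueWeight≤k
    ... | yes (x , x∈S , w≥2) = add cliqueWeight≤k length-rest<k
      where
      w₁ : Fin n → ℕ
      w₁ = updateAt w x ℕ.pred

      w₁x : w₁ x ≡ ℕ.pred (w x)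
      w₁x = updateAt-updates x w

      w₁≢x : ∀ {v} → v ≢ x → w₁ v ≡ w v
      w₁≢x {v} v≢x = updateAt-minimal v x w v≢x

      w₁≤w : ∀ v → w₁ v ℕ.≤ w v
      w₁≤w v with v ≟ x
      ... | yes refl = subst (ℕ._≤ w x) (sym w₁x) ℕ.pred[n]≤n
      ... | no v≢x   = ℕ.≤-reflexive (w₁≢x v≢x)

      pred-< : ∀ {m} → 2 ℕ.≤ m → ℕ.pred m ℕ.< m
      pred-< (s≤s _) = ℕ.n<1+n _

      module C₁ = Cover (go w₁
        (rec (weight-mono-< S x∈S w₁≤w (subst (ℕ._< w x) (sym w₁x) (pred-< w≥2))))
        (λ K K⊆S clique → ℕ.≤-trans
          (weight-mono-≤ K λ {v} _ → w₁≤w v) (cliqueWeight≤k K K⊆S clique)))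

      -- From `w x ≥ 2` follows `w₁ x ≥ 1`, so the first cover has a class through `x`.
      open Removal (remove C₁.independent (ℕ.≤-trans
        (subst (1 ℕ.≤_) (sym w₁x) (ℕ.pred-mono-≤ w≥2)) (C₁.covers x∈S)))
        renaming (removed to A)

      length-rest<k : length rest ℕ.< k
      length-rest<k = subst (ℕ._≤ k) length≡ C₁.length≤

      -- The subtraction may truncate, since `A` can contain vertices of weight 0;
      -- `w v ≤ indicator A v + w₂ v` holds all the same.
      w₂ : Fin n → ℕ
      w₂ v = w v ℕ.∸ indicator A v

      w₂≤w : ∀ v → w₂ v ℕ.≤ w v
      w₂≤w v = ℕ.m∸n≤m (w v) (indicator A v)

      w₂x<wx : w₂ x ℕ.< w x
      w₂x<wx = subst (λ i → w x ℕ.∸ i ℕ.< w x) (sym (∈⇒indicator≡1 v∈)) (pred-< w≥2)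

      w₂≤coverage : ∀ {v} → v ∈ S → v ≢ x → w₂ v ℕ.≤ coverage rest v
      w₂≤coverage {v} v∈S v≢x = ℕ.m≤n+o⇒m∸n≤o (w v) (indicator A v) (begin
        w v                                ≡⟨ w₁≢x v≢x ⟨
        w₁ v                               ≤⟨ C₁.covers v∈S ⟩
        coverage C₁.classes v              ≡⟨ coverage≡ v ⟩
        indicator A v ℕ.+ coverage rest v  ∎)
        where open ℕ.≤-Reasoning

      -- The strict bound on `rest` forces the number of allowed classes to be a successor; the
      -- extra one is spent on `A`.
      add : ∀ {k} → CliqueWeight≤ S w k → length rest ℕ.< k → Cover S w k
      add {suc k} cliqueWeight≤ (s≤s length-rest≤k) = record
        { classes = A ∷ C₂.classes
        ; independent = P-removed ∷ C₂.independent
        ; length≤ = s≤s C₂.length≤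
        ; covers = λ {v} v∈S → ℕ.≤-trans (ℕ.m≤n+m∸n (w v) (indicator A v))
            (ℕ.+-monoʳ-≤ (indicator A v) (C₂.covers v∈S))
        }
        where
        cliqueWeight₂≤ : CliqueWeight≤ S w₂ k
        cliqueWeight₂≤ K K⊆S clique with x ∈? K
        ... | yes x∈K = ℕ.≤-pred (ℕ.<-≤-trans (weight-mono-< K x∈K w₂≤w w₂x<wx)
                          (cliqueWeight≤ K K⊆S clique))
        ... | no x∉K = begin
            weight K w₂               ≤⟨ weight-mono-≤ K (λ v∈K →
                                          w₂≤coverage (K⊆S v∈K) λ { refl → x∉K v∈K }) ⟩
            weight K (coverage rest)  ≤⟨ weight-coverage≤length clique P-rest ⟩
            length rest               ≤⟨ length-rest≤k ⟩
            k                         ∎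
          where open ℕ.≤-Reasoning

        module C₂ = Cover (go w₂ (rec (weight-mono-< S x∈S w₂≤w w₂x<wx)) cliqueWeight₂≤)

-- Clearing denominators

-- `N` is the product of all values of `c`, and `w v` is the quotient N / c(v), built as the product
-- of the other values.
commonMultiple : ∀ {n} (S : Subset n) (c : Vertex S → ℕ) → (∀ v → NonZero (c v)) →
                 ∃₂ λ N (w : Fin n → ℕ) → NonZero N × (∀ v → w (proj₁ v) ℕ.* c v ≡ N)
commonMultiple []            c c≢0 = 1 , (λ ()) , _ , λ ()
commonMultiple (inside ∷ S)  c c≢0 =
  let N , w , N≢0 , w*c≡N = commonMultiple S
        (λ (v , v∈S) → c (suc v , there v∈S)) λ (v , v∈S) → c≢0 (suc v , there v∈S)
      c₀ = c (zero , here)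
  in N ℕ.* c₀
   , (λ { zero → N ; (suc v) → w v ℕ.* c₀ })
   , ℕ.m*n≢0 N c₀ {{N≢0}} {{c≢0 (zero , here)}}
   , λ { (zero , here)       → refl
       ; (suc v , there v∈S) → trans (m*n*o≡m*o*n (w v) c₀ (c (suc v , there v∈S)))
                                 (cong (ℕ._* c₀) (w*c≡N (v , v∈S))) }
commonMultiple (outside ∷ S) c c≢0 =
  let N , w , N≢0 , w*c≡N = commonMultiple S
        (λ (v , v∈S) → c (suc v , there v∈S)) λ (v , v∈S) → c≢0 (suc v , there v∈S)
  in N
   -- The value outside `S` is arbitrary: the specification speaks of vertices of `S` only.
   , (λ { zero → 0 ; (suc v) → w v })
   , N≢0
   , λ { (suc v , there v∈S) → w*c≡N (v , v∈S) }

-- Order and addition of real numbers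

≤-trans : ∀ {x y z} → x ≤ y → y ≤ z → x ≤ z
≤-trans x≤y y≤z q = y≤z q ∘ x≤y q

≈-isEquivalence : IsEquivalence _≈_
≈-isEquivalence = record
  { refl  = (λ _ → id) , (λ _ → id)
  ; sym   = λ (x≤y , y≤x) → y≤x , x≤y
  ; trans = λ {x y z} (x≤y , y≤x) (y≤z , z≤y) →
      ≤-trans {x} {y} {z} x≤y y≤z , ≤-trans {z} {y} {x} z≤y y≤x
  }

≤-poset : Poset (lsuc 0ℓ) 0ℓ 0ℓ
≤-poset = record
  { Carrier = ℝ
  ; isPartialOrder = record
    { isPreorder = record
      { isEquivalence = ≈-isEquivalence
      ; reflexive     = proj₁
      ; trans         = λ {x y z} → ≤-trans {x} {y} {z}
      }
    ; antisym = _,_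
    }
  }

module ≤-Reasoning = PosetReasoning ≤-poset

lower-down-≤ : ∀ x {q r} → q ℚ.≤ r → Lower x r → Lower x q
lower-down-≤ x q≤r r∈L = let s , r<s , s∈L = lower-open x r∈L in
  lower-down x (ℚ.≤-<-trans q≤r r<s) s∈L

+-mono-≤ : ∀ {x x′ y y′} → x ≤ x′ → y ≤ y′ → x + y ≤ x′ + y′
+-mono-≤ x≤x′ y≤y′ q (a , b , a∈L , b∈L , q<a+b) = a , b , x≤x′ a a∈L , y≤y′ b b∈L , q<a+b

+-comm-≤ : ∀ x y → x + y ≤ y + x
+-comm-≤ x y q (a , b , a∈L , b∈L , q<a+b) =
  b , a , b∈L , a∈L , subst (q ℚ.<_) (ℚ.+-comm a b) q<a+b

+-assoc-≤ : ∀ x y z → (x + y) + z ≤ x + (y + z)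
+-assoc-≤ x y z q (c , d , (a , b , a∈L , b∈L , c<a+b) , d∈L , q<c+d) =
  -- Membership in the lower cut of a sum is strict, so `d` is first enlarged to make room above
  -- `b + d`.
  let d′ , d<d′ , d′∈L = lower-open z d∈L in
  a , b ℚ.+ d , a∈L , (b , d′ , b∈L , d′∈L , ℚ.+-monoʳ-< b d<d′) ,
  ℚ.<-trans q<c+d (subst (c ℚ.+ d ℚ.<_) (ℚ.+-assoc a b d) (ℚ.+-monoˡ-< d c<a+b))

+-assoc-≥ : ∀ x y z → x + (y + z) ≤ (x + y) + z
+-assoc-≥ x y z = begin
  x + (y + z)  ≤⟨ +-comm-≤ x (y + z) ⟩
  (y + z) + x  ≤⟨ +-assoc-≤ y z x ⟩
  y + (z + x)  ≤⟨ +-comm-≤ y (z + x) ⟩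
  (z + x) + y  ≤⟨ +-assoc-≤ z x y ⟩
  z + (x + y)  ≤⟨ +-comm-≤ z (x + y) ⟩
  (x + y) + z  ∎
  where open ≤-Reasoning

+-identityˡ-≤ : ∀ x → 0ℝ + x ≤ x
+-identityˡ-≤ x q (a , b , a<0 , b∈L , q<a+b) = lower-down x
  (ℚ.<-trans q<a+b (subst (a ℚ.+ b ℚ.<_) (ℚ.+-identityˡ b) (ℚ.+-monoˡ-< b a<0))) b∈L

+-identityˡ-≥ : ∀ x → x ≤ 0ℝ + x
+-identityˡ-≥ x q q∈L =
  let r , q<r , r∈L = lower-open x q∈L
      s , q<s , s<r = ℚ.<-dense q<r
  -- With q < s < r, the number `s - r` is negative, hence below 0, and its sum with `r` is `s`,
  -- still above `q`.
  in s ℚ.- r , r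
   , subst (s ℚ.- r ℚ.<_) (ℚ.+-inverseʳ r) (ℚ.+-monoˡ-< (ℚ.- r) s<r)
   , r∈L
   , subst (q ℚ.<_) (solve 2 (λ r s → s := (s :+ :- r) :+ r) refl r s) q<s
  where open +-*-Solver

+-commutativeMonoid : CommutativeMonoid (lsuc 0ℓ) 0ℓ
+-commutativeMonoid = record
  { Carrier = ℝ ; _≈_ = _≈_ ; _∙_ = _+_ ; ε = 0ℝ
  ; isCommutativeMonoid = record
    { isMonoid = record
      { isSemigroup = record
        { isMagma = record
          { isEquivalence = ≈-isEquivalence
          ; ∙-cong = λ {x y u v} (x≤y , y≤x) (u≤v , v≤u) →
              +-mono-≤ {x} {y} {u} {v} x≤y u≤v , +-mono-≤ {y} {x} {v} {u} y≤x v≤u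
          }
        ; assoc = λ x y z → +-assoc-≤ x y z , +-assoc-≥ x y z
        }
      ; identity = +-identityˡ , λ x → IsEquivalence.trans ≈-isEquivalence {x + 0ℝ} {0ℝ + x} {x}
          (+-comm x 0ℝ) (+-identityˡ x)
      }
    ; comm = +-comm
    }
  }
  where
  +-comm : ∀ x y → x + y ≈ y + x
  +-comm x y = +-comm-≤ x y , +-comm-≤ y x

  +-identityˡ : ∀ x → 0ℝ + x ≈ x
  +-identityˡ x = +-identityˡ-≤ x , +-identityˡ-≥ x

open CommutativeMonoid +-commutativeMonoid
  using (commutativeSemigroup)
  renaming (refl to ≈-refl; identityˡ to +-identityˡ; identityʳ to +-identityʳ)
open import Algebra.Properties.CommutativeMonoid.Mult +-commutativeMonoid
  using (×-homo-1; ×-homo-+; ×-assocˡ; ×-distrib-+; ×-idem)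
open import Algebra.Properties.CommutativeSemigroup commutativeSemigroup using (interchange)

-- Natural multiples of real numbers

·-monoʳ-≤ : ∀ n x y → x ≤ y → n · x ≤ n · y
·-monoʳ-≤ zero    x y x≤y = λ _ → id
·-monoʳ-≤ (suc n) x y x≤y = +-mono-≤ {x} {y} {n · x} {n · y} x≤y (·-monoʳ-≤ n x y x≤y)

·-zeroʳ : ∀ n → n · 0ℝ ≈ 0ℝ
·-zeroʳ zero    = ≈-refl {0ℝ}
·-zeroʳ (suc n) = ×-idem (+-identityˡ 0ℝ) (suc n)

·-monoˡ-≤ : ∀ {m n} x → 0ℝ ≤ x → m ℕ.≤ n → m · x ≤ n · x
·-monoˡ-≤ {n = n} x 0≤x z≤n = begin
  0ℝ      ≈⟨ ·-zeroʳ n ⟨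
  n · 0ℝ  ≤⟨ ·-monoʳ-≤ n 0ℝ x 0≤x ⟩
  n · x   ∎
  where open ≤-Reasoning
·-monoˡ-≤ {suc m} {suc n} x 0≤x (s≤s m≤n) =
  +-mono-≤ {x} {x} {m · x} {n · x} (λ _ → id) (·-monoˡ-≤ x 0≤x m≤n)

0≤fromℕ : ∀ n → 0ℚ ℚ.≤ fromℕ n
0≤fromℕ zero    = ℚ.≤-refl
0≤fromℕ (suc n) = ℚ.+-mono-≤ (ℚ.<⇒≤ 0<1) (0≤fromℕ n)

0<fromℕ : ∀ n .{{_ : NonZero n}} → 0ℚ ℚ.< fromℕ n
0<fromℕ (suc n) = ℚ.+-mono-<-≤ 0<1 (0≤fromℕ n)

fromℕ-*-mono-≤ : ∀ n {p q} → p ℚ.≤ q → fromℕ n ℚ.* p ℚ.≤ fromℕ n ℚ.* q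
fromℕ-*-mono-≤ n = ℚ.*-monoˡ-≤-nonNeg (fromℕ n) {{ℚ.nonNegative (0≤fromℕ n)}}

fromℕ-suc-* : ∀ n p → fromℕ (suc n) ℚ.* p ≡ p ℚ.+ fromℕ n ℚ.* p
fromℕ-suc-* n p = trans (ℚ.*-distribʳ-+ p 1ℚ (fromℕ n))
  (cong (ℚ._+ fromℕ n ℚ.* p) (ℚ.*-identityˡ p))

-- Applied with `m` the weight of a vertex, `n` its clique size and `k` its coverage, so that
-- `m * n` is the common multiple.
*-·-mono-≤ : ∀ m n {k} x y → 0ℝ ≤ y → n · x ≤ y → m ℕ.≤ k → (m ℕ.* n) · x ≤ k · y
*-·-mono-≤ m n {k} x y 0≤y nx≤y m≤k = begin
  (m ℕ.* n) · x  ≈⟨ ×-assocˡ x m n ⟨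
  m · (n · x)    ≤⟨ ·-monoʳ-≤ m (n · x) y nx≤y ⟩
  m · y          ≤⟨ ·-monoˡ-≤ y 0≤y m≤k ⟩
  k · y          ∎
  where open ≤-Reasoning

-- For `n = 0` this would claim 0 < 0, so the induction starts at 1. Strictness in each further step
-- comes from a lower bound `r` above `q`.
·-lower⁺ : ∀ n .{{_ : NonZero n}} x {q} → Lower x q → Lower (n · x) (fromℕ n ℚ.* q)
·-lower⁺ (suc zero) x {q} q∈L = subst (Lower (x + 0ℝ)) (sym (ℚ.*-identityˡ q))
  (proj₂ (+-identityʳ x) q q∈L)
·-lower⁺ (suc (suc n)) x {q} q∈L = let r , q<r , r∈L = lower-open x q∈L in
  r , fromℕ (suc n) ℚ.* q , r∈L , ·-lower⁺ (suc n) x q∈L ,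
  subst (ℚ._< r ℚ.+ fromℕ (suc n) ℚ.* q) (sym (fromℕ-suc-* (suc n) q))
    (ℚ.+-monoˡ-< (fromℕ (suc n) ℚ.* q) q<r)

-- Each summand comes with its own rational in the lower cut; the largest of them serves for all.
·-lower⁻ : ∀ n x {q} → Lower (n · x) q → ∃ λ r → Lower x r × q ℚ.≤ fromℕ n ℚ.* r
·-lower⁻ zero x {q} q<0 = let r , r∈L = lower-inhabited x in
  r , r∈L , ℚ.<⇒≤ (subst (q ℚ.<_) (sym (ℚ.*-zeroˡ r)) q<0)
·-lower⁻ (suc n) x {q} (a , b , a∈L , b∈L , q<a+b) with ·-lower⁻ n x b∈L
... | r , r∈L , b≤nr = a ℚ.⊔ r
  , [ (λ eq → subst (Lower x) (sym eq) a∈L)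
    , (λ eq → subst (Lower x) (sym eq) r∈L)
    ]′ (ℚ.⊔-sel a r)
  , (begin
      q                                    ≤⟨ ℚ.<⇒≤ q<a+b ⟩
      a ℚ.+ b                              ≤⟨ ℚ.+-mono-≤ (ℚ.p≤p⊔q a r)
                                              (ℚ.≤-trans b≤nr (fromℕ-*-mono-≤ n (ℚ.p≤q⊔p a r))) ⟩
      a ℚ.⊔ r ℚ.+ fromℕ n ℚ.* (a ℚ.⊔ r)    ≡⟨ fromℕ-suc-* n (a ℚ.⊔ r) ⟨
      fromℕ (suc n) ℚ.* (a ℚ.⊔ r)          ∎)
  where open ℚ.≤-Reasoning

·-upper⁻ : ∀ n x {q} → Upper (n · x) q → ∃ λ r → Upper x r × fromℕ n ℚ.* r ℚ.≤ q
·-upper⁻ zero x {q} 0<q = let r , r∈U = upper-inhabited x in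
  r , r∈U , ℚ.<⇒≤ (subst (ℚ._< q) (sym (ℚ.*-zeroˡ r)) 0<q)
·-upper⁻ (suc n) x {q} (a , b , a∈U , b∈U , a+b<q) with ·-upper⁻ n x b∈U
... | r , r∈U , nr≤b = a ℚ.⊓ r
  , [ (λ eq → subst (Upper x) (sym eq) a∈U)
    , (λ eq → subst (Upper x) (sym eq) r∈U)
    ]′ (ℚ.⊓-sel a r)
  , (begin
      fromℕ (suc n) ℚ.* (a ℚ.⊓ r)          ≡⟨ fromℕ-suc-* n (a ℚ.⊓ r) ⟩
      a ℚ.⊓ r ℚ.+ fromℕ n ℚ.* (a ℚ.⊓ r)    ≤⟨ ℚ.+-mono-≤ (ℚ.p⊓q≤p a r)
                                              (ℚ.≤-trans (fromℕ-*-mono-≤ n (ℚ.p⊓q≤q a r)) nr≤b) ⟩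
      a ℚ.+ b                              ≤⟨ ℚ.<⇒≤ a+b<q ⟩
      q                                    ∎)
  where open ℚ.≤-Reasoning

-- A rational below `x` is scaled into the lower cut of `n · x`, carried to that of `n · y`, and
-- divided by `n` in ℚ.
·-cancel-≤ : ∀ n .{{_ : NonZero n}} x y → n · x ≤ n · y → x ≤ y
·-cancel-≤ n x y nx≤ny q q∈L =
  let r , r∈L , nq≤nr = ·-lower⁻ n y (nx≤ny _ (·-lower⁺ n x q∈L))
  in lower-down-≤ y (ℚ.*-cancelˡ-≤-pos (fromℕ n) {{ℚ.positive (0<fromℕ n)}} nq≤nr) r∈L

-- Reciprocals

recip-anti-≤ : ∀ x y 0<x 0<y → x ≤ y → recip y 0<y ≤ recip x 0<x
recip-anti-≤ x y _ _ x≤y q (r , r∈U , rq<1) =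
  let s , s<r , s∈U = upper-open y r∈U
  in r
   -- The order is defined by lower cuts, while an upper bound of `x` is wanted. Locatedness of `x`
   -- between `s` and `r` yields it: were `s` below `x`, it would be both below and above `y`.
   , [ (λ s∈L → contradiction (x≤y s s∈L , s∈U) (disjoint y s)) , id ]′ (located x s<r)
   , rq<1

0≤recip : ∀ x 0<x → 0ℝ ≤ recip x 0<x
0≤recip x (p , 0<p , p∈L) q q<0 = let r , r∈U = upper-inhabited x in
  r , r∈U , ℚ.≤-<-trans (*-nonpos (ℚ.<-trans 0<p (lower<upper x p∈L r∈U)) (ℚ.<⇒≤ q<0)) 0<1

·-recip-≤ : ∀ n x 0<x 0<nx → n · recip (n · x) 0<nx ≤ recip x 0<x
·-recip-≤ n x (p , 0<p , p∈L) 0<nx q q∈L =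
  let b , (r , r∈U , rb<1) , q≤nb = ·-lower⁻ n (recip (n · x) 0<nx) q∈L
      s , s∈U , ns≤r = ·-upper⁻ n x r∈U
  in s , s∈U , bound r s b (ℚ.<-trans 0<p (lower<upper x p∈L s∈U)) rb<1 q≤nb ns≤r
  where
  bound : ∀ r s b → 0ℚ ℚ.< s → r ℚ.* b ℚ.< 1ℚ → q ℚ.≤ fromℕ n ℚ.* b → fromℕ n ℚ.* s ℚ.≤ r →
          s ℚ.* q ℚ.< 1ℚ
  -- The chain s q ≤ s (n b) = (n s) b ≤ r b < 1 multiplies `n s ≤ r` by `b`, which needs `b`
  -- positive; otherwise `q` is at most 0 and the product `s q` is too.
  bound r s b 0<s rb<1 q≤nb ns≤r with b ℚ.≤? 0ℚ
  ... | yes b≤0 = ℚ.≤-<-trans (*-nonpos 0<s (ℚ.≤-trans q≤nb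
          (subst (fromℕ n ℚ.* b ℚ.≤_) (ℚ.*-zeroʳ (fromℕ n)) (fromℕ-*-mono-≤ n b≤0)))) 0<1
  ... | no b≰0 = begin-strict
      s ℚ.* q                  ≤⟨ ℚ.*-monoˡ-≤-nonNeg s {{ℚ.nonNegative (ℚ.<⇒≤ 0<s)}} q≤nb ⟩
      s ℚ.* (fromℕ n ℚ.* b)    ≡⟨ solve 3 (λ s n b → s :* (n :* b) := (n :* s) :* b) refl
                                    s (fromℕ n) b ⟩
      (fromℕ n ℚ.* s) ℚ.* b    ≤⟨ ℚ.*-monoʳ-≤-nonNeg b
                                    {{ℚ.nonNegative (ℚ.<⇒≤ (ℚ.≰⇒> b≰0))}} ns≤r ⟩
      r ℚ.* b                  <⟨ rb<1 ⟩
      1ℚ                       ∎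
    where
    open ℚ.≤-Reasoning
    open +-*-Solver

-- Finite sums over vertex sets

tail : ∀ {n s} {S : Subset n} → (Vertex (s ∷ S) → ℝ) → Vertex S → ℝ
tail g (v , v∈S) = g (suc v , there v∈S)

+-nonposˡ : ∀ a x y → a ≤ 0ℝ → x ≤ y → a + x ≤ y
+-nonposˡ a x y a≤0 x≤y = begin
  a + x   ≤⟨ +-mono-≤ {a} {0ℝ} {x} {y} a≤0 x≤y ⟩
  0ℝ + y  ≈⟨ +-identityˡ y ⟩
  y       ∎
  where open ≤-Reasoning

∑-nonpos : ∀ {n} (S : Subset n) g → (∀ v → g v ≤ 0ℝ) → ∑ S g ≤ 0ℝ
∑-nonpos []            g g≤0 = λ _ → id
∑-nonpos (inside ∷ S)  g g≤0 = +-nonposˡ (g (zero , here)) (∑ S (tail g)) 0ℝ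
  (g≤0 (zero , here)) (∑-nonpos S (tail g) λ (v , v∈S) → g≤0 (suc v , there v∈S))
∑-nonpos (outside ∷ S) g g≤0 = ∑-nonpos S (tail g) λ (v , v∈S) → g≤0 (suc v , there v∈S)

+-interchange-≤ : ∀ a b c x y z → a ≤ b + c → x ≤ y + z → a + x ≤ (b + y) + (c + z)
+-interchange-≤ a b c x y z a≤b+c x≤y+z = begin
  a + x              ≤⟨ +-mono-≤ {a} {b + c} {x} {y + z} a≤b+c x≤y+z ⟩
  (b + c) + (y + z)  ≈⟨ interchange b c y z ⟩
  (b + y) + (c + z)  ∎
  where open ≤-Reasoning

∑-+-≤ : ∀ {n} (S : Subset n) g h k → (∀ v → g v ≤ h v + k v) → ∑ S g ≤ ∑ S h + ∑ S k
∑-+-≤ []            g h k g≤h+k = proj₂ (+-identityˡ 0ℝ)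
∑-+-≤ (inside ∷ S)  g h k g≤h+k = +-interchange-≤
  (g (zero , here)) (h (zero , here)) (k (zero , here))
  (∑ S (tail g)) (∑ S (tail h)) (∑ S (tail k))
  (g≤h+k (zero , here)) (∑-+-≤ S (tail g) (tail h) (tail k)
    λ (v , v∈S) → g≤h+k (suc v , there v∈S))
∑-+-≤ (outside ∷ S) g h k g≤h+k =
  ∑-+-≤ S (tail g) (tail h) (tail k) λ (v , v∈S) → g≤h+k (suc v , there v∈S)

·-distrib-+-≤ : ∀ m a b x y → m · a ≤ b → m · x ≤ y → m · (a + x) ≤ b + y
·-distrib-+-≤ m a b x y ma≤b mx≤y = begin
  m · (a + x)    ≈⟨ ×-distrib-+ a x m ⟩
  m · a + m · x  ≤⟨ +-mono-≤ {m · a} {b} {m · x} {y} ma≤b mx≤y ⟩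
  b + y          ∎
  where open ≤-Reasoning

∑-·-≤ : ∀ {n} (S : Subset n) m g h → (∀ v → m · g v ≤ h v) → m · ∑ S g ≤ ∑ S h
∑-·-≤ []            m g h mg≤h = proj₁ (·-zeroʳ m)
∑-·-≤ (inside ∷ S)  m g h mg≤h = ·-distrib-+-≤ m
  (g (zero , here)) (h (zero , here)) (∑ S (tail g)) (∑ S (tail h))
  (mg≤h (zero , here)) (∑-·-≤ S m (tail g) (tail h) λ (v , v∈S) → mg≤h (suc v , there v∈S))
∑-·-≤ (outside ∷ S) m g h mg≤h =
  ∑-·-≤ S m (tail g) (tail h) λ (v , v∈S) → mg≤h (suc v , there v∈S)

-- Terms outside `I` are nonpositive and may be dropped. The termwise comparison ranges over all
-- membership proofs because a vertex carries different ones in `S` and in `S ∩ I`.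
∑-restrict-≤ : ∀ {n} (S I : Subset n) g h → (∀ v p q → g (v , p) ≤ h (v , q)) →
               (∀ v → proj₁ v ∉ I → g v ≤ 0ℝ) → ∑ S g ≤ ∑ (S ∩ I) h
∑-restrict-≤ []            []            g h g≤h g≤0 = λ _ → id
∑-restrict-≤ (inside ∷ S)  (inside ∷ I)  g h g≤h g≤0 =
  +-mono-≤ {g (zero , here)} {h (zero , here)} {∑ S (tail g)} {∑ (S ∩ I) (tail h)}
    (g≤h zero here here)
    (∑-restrict-≤ S I (tail g) (tail h) (λ v p q → g≤h (suc v) (there p) (there q))
      λ (v , p) v∉I → g≤0 (suc v , there p) (v∉I ∘ drop-there))
∑-restrict-≤ (inside ∷ S)  (outside ∷ I) g h g≤h g≤0 = +-nonposˡ
  (g (zero , here)) (∑ S (tail g)) (∑ (S ∩ I) (tail h))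
  (g≤0 (zero , here) λ ())
  (∑-restrict-≤ S I (tail g) (tail h) (λ v p q → g≤h (suc v) (there p) (there q))
    λ (v , p) v∉I → g≤0 (suc v , there p) (v∉I ∘ drop-there))
∑-restrict-≤ (outside ∷ S) (i ∷ I)       g h g≤h g≤0 =
  ∑-restrict-≤ S I (tail g) (tail h) (λ v p q → g≤h (suc v) (there p) (there q))
    λ (v , p) v∉I → g≤0 (suc v , there p) (v∉I ∘ drop-there)

-- Double counting: coverage is a sum of indicators, so the left side splits into one sum per class,
-- and each of these is at most 1.
∑-coverage-≤ : ∀ {n} (S : Subset n) (r : Vertex S → ℝ) (h : ∀ I → Vertex (S ∩ I) → ℝ) →
               (∀ I v p q → r (v , p) ≤ h I (v , q)) →
               ∀ {Is} → All (λ I → ∑ (S ∩ I) (h I) ≤ 1ℝ) Is →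
               ∑ S (λ v → coverage Is (proj₁ v) · r v) ≤ length Is · 1ℝ
∑-coverage-≤ S r h r≤h []                        = ∑-nonpos S (const 0ℝ) λ _ _ → id
∑-coverage-≤ S r h r≤h {I ∷ Is} (∑h≤1 ∷ ∑hs≤1) = begin
  ∑ S (λ v → coverage (I ∷ Is) (proj₁ v) · r v)  ≤⟨ ∑-+-≤ S (λ v → coverage (I ∷ Is) (proj₁ v) · r v)
                                                      rI rIs split ⟩
  ∑ S rI + ∑ S rIs                               ≤⟨ +-mono-≤ {∑ S rI} {1ℝ} {∑ S rIs} {length Is · 1ℝ}
                                                      class≤1 (∑-coverage-≤ S r h r≤h ∑hs≤1) ⟩
  1ℝ + length Is · 1ℝ                            ∎
  where
  open ≤-Reasoning

  rI rIs : Vertex S → ℝ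
  rI  v = indicator I (proj₁ v) · r v
  rIs v = coverage Is (proj₁ v) · r v

  split : ∀ v → coverage (I ∷ Is) (proj₁ v) · r v ≤ rI v + rIs v
  split v = proj₁ (×-homo-+ (r v) (indicator I (proj₁ v)) (coverage Is (proj₁ v)))

  rI≤ : ∀ v p q → rI (v , p) ≤ h I (v , q)
  rI≤ v p q = begin
    indicator I v · r (v , p)  ≡⟨ cong (_· r (v , p)) (∈⇒indicator≡1 (p∩q⊆q S I q)) ⟩
    1 · r (v , p)              ≈⟨ ×-homo-1 (r (v , p)) ⟩
    r (v , p)                  ≤⟨ r≤h I v p q ⟩
    h I (v , q)                ∎

  rI≤0 : ∀ v → proj₁ v ∉ I → rI v ≤ 0ℝ
  rI≤0 v v∉I q q∈L = subst (λ i → Lower (i · r v) q) (∉⇒indicator≡0 v∉I) q∈L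

  class≤1 : ∑ S rI ≤ 1ℝ
  class≤1 = ≤-trans {∑ S rI} {∑ (S ∩ I) (h I)} {1ℝ} (∑-restrict-≤ S I rI (h I) rI≤ rI≤0) ∑h≤1

-- Monotonicity of f and the final estimate

-- Vertices of `S` missing from `T` are added one at a time; this terminates because strict
-- supersets are well-founded on a finite vertex set.
⊆-mono-≤ : ∀ {n} (f : (S : Subset n) → Vertex S → ℝ) →
           (∀ S (v : Vertex S) (w : Fin n) → w ∉ S → f S v ≤ f (S ∪ ⁅ w ⁆) (extend w v)) →
           ∀ {S T v} (v∈T : v ∈ T) (v∈S : v ∈ S) → T ⊆ S → f T (v , v∈T) ≤ f S (v , v∈S)
⊆-mono-≤ {n} f f-mono {S} {v = v} v∈T v∈S = go _ (⊃-wellFounded _) v∈T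
  where
  go : ∀ T → Acc _⊃_ T → (v∈T : v ∈ T) → T ⊆ S → f T (v , v∈T) ≤ f S (v , v∈S)
  go T (acc rec) v∈T T⊆S with any? (λ w → (w ∈? S) ×-dec ¬? (w ∈? T))
  ... | yes (w , w∈S , w∉T) = ≤-trans
          {f T (v , v∈T)} {f (T ∪ ⁅ w ⁆) (extend w (v , v∈T))} {f S (v , v∈S)}
          (f-mono T (v , v∈T) w w∉T)
          (go (T ∪ ⁅ w ⁆) (rec (p⊆p∪q ⁅ w ⁆ , w , q⊆p∪q T ⁅ w ⁆ (x∈⁅x⁆ w) , w∉T))
            (p⊆p∪q ⁅ w ⁆ v∈T) ∪⊆S)
    where
    ∪⊆S : T ∪ ⁅ w ⁆ ⊆ S
    ∪⊆S = [ T⊆S , (λ u∈ → subst (_∈ S) (sym (x∈⁅y⁆⇒x≡y w u∈)) w∈S) ]′ ∘ x∈p∪q⁻ T ⁅ w ⁆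
  ... | no none = equal (⊆-antisym T⊆S λ {u} u∈S →
          decidable-stable (u ∈? T) λ u∉T → none (u , u∈S , u∉T)) v∈T
    where
    equal : ∀ {T} → T ≡ S → (v∈T : v ∈ T) → f T (v , v∈T) ≤ f S (v , v∈S)
    equal refl v∈T q q∈L = subst (λ p → Lower (f S (v , p)) q) ([]=-irrelevant v∈T v∈S) q∈L

-- Here `g` stands for f(S,·) and `z I` for 1/f(S ∩ I,·), while `c` is any positive bound on the
-- sizes of the cliques of G[S] through a vertex.
perfect⇒∑≤1 : ∀ {n} (G : Graph n) → IsPerfect G →
              ∀ (S : Subset n) (c : Vertex S → ℕ) (g : Vertex S → ℝ)
              (z : ∀ I → Vertex (S ∩ I) → ℝ)
              (g>0 : ∀ v → 0ℝ < g v) (cg>0 : ∀ v → 0ℝ < c v · g v) →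
              (∀ v → NonZero (c v)) →
              (∀ {K} v → K ⊆ S → IsClique G K → proj₁ v ∈ K → ∣ K ∣ ℕ.≤ c v) →
              (∀ I v p q → recip (g (v , p)) (g>0 (v , p)) ≤ z I (v , q)) →
              (∀ {I} → IsIndependent G I → ∑ (S ∩ I) (z I) ≤ 1ℝ) →
              ∑ S (λ v → recip (c v · g v) (cg>0 v)) ≤ 1ℝ
perfect⇒∑≤1 {n} G perfect S c g z g>0 cg>0 c≢0 ∣K∣≤c y≤z ∑z≤1 =
  ·-cancel-≤ N {{N≢0}} (∑ S x) 1ℝ (begin
  N · ∑ S x                                     ≤⟨ ∑-·-≤ S N x
                                                     (λ v → coverage classes (proj₁ v) · y v) Nx≤ ⟩
  ∑ S (λ v → coverage classes (proj₁ v) · y v)  ≤⟨ ∑-coverage-≤ S y z y≤z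
                                                     (All.map ∑z≤1 independent) ⟩
  length classes · 1ℝ                           ≤⟨ ·-monoˡ-≤ 1ℝ (λ _ q<0 → ℚ.<-trans q<0 0<1) length≤ ⟩
  N · 1ℝ                                        ∎)
  where
  open ≤-Reasoning

  x y : Vertex S → ℝ
  x v = recip (c v · g v) (cg>0 v)
  y v = recip (g v) (g>0 v)

  multiple : ∃₂ λ N (w : Fin n → ℕ) → NonZero N × (∀ v → w (proj₁ v) ℕ.* c v ≡ N)
  multiple = commonMultiple S c c≢0

  N : ℕ
  N = proj₁ multiple

  w : Fin n → ℕ
  w = proj₁ (proj₂ multiple)

  N≢0 : NonZero N
  N≢0 = proj₁ (proj₂ (proj₂ multiple))

  w*c≡N : ∀ v → w (proj₁ v) ℕ.* c v ≡ N
  w*c≡N = proj₂ (proj₂ (proj₂ multiple))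

  cliqueWeight≤N : CliqueWeight≤ G S w N
  cliqueWeight≤N K K⊆S clique = weight≤ K λ {v} v∈K → ℕ.≤-trans
    (ℕ.*-monoʳ-≤ (w v) (∣K∣≤c (v , K⊆S v∈K) K⊆S clique v∈K))
    (ℕ.≤-reflexive (w*c≡N (v , K⊆S v∈K)))

  open Cover (perfect⇒cover G perfect cliqueWeight≤N)

  -- Since N = w(v) c(v), the multiple N/(c(v) g(v)) is at most w(v)/g(v), and `v` is covered at
  -- least w(v) times.
  Nx≤ : ∀ v → N · x v ≤ coverage classes (proj₁ v) · y v
  Nx≤ v = subst (λ k → k · x v ≤ coverage classes (proj₁ v) · y v) (w*c≡N v)
    (*-·-mono-≤ (w (proj₁ v)) (c v) (x v) (y v) (0≤recip (g v) (g>0 v))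
      (·-recip-≤ (c v) (g v) (g>0 v) (cg>0 v)) (covers (proj₂ v)))

theorem7 : ∀ {n : ℕ} (G : Graph n) → IsPerfect G →
    (f : (S : Subset n) → Vertex S → ℝ) (f>0 : ∀ S v → 0ℝ < f S v) →
    (∀ S (v : Vertex S) (w : Fin n) → w ∉ S → f S v ≤ f (S ∪ ⁅ w ⁆) (extend w v)) →
    (∀ S → IsIndependent G S → ∑ S (λ v → recip (f S v) (f>0 S v)) ≤ 1ℝ) →
    ∀ S → ∑ S (λ v → recip (cliqueNumberAt G S v · f S v) (0<c·x G S v (f>0 S v))) ≤ 1ℝ
theorem7 G perfect f f>0 f-mono ∑1/f≤1 S = perfect⇒∑≤1 G perfect S
  (cliqueNumberAt G S)
  (f S)
  (λ I v → recip (f (S ∩ I) v) (f>0 (S ∩ I) v))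
  (f>0 S)
  (λ v → 0<c·x G S v {f S v} (f>0 S v))
  (cliqueNumberAt-nonZero G S)
  (λ (v , _) K⊆S clique v∈K → ∣S∣≤largest
    (λ K → (K ⊆? S) ×-dec (isClique? G K ×-dec (v ∈? K))) (K⊆S , clique , v∈K))
  (λ I v p q → recip-anti-≤ (f (S ∩ I) (v , q)) (f S (v , p))
    (f>0 (S ∩ I) (v , q)) (f>0 S (v , p))
    (⊆-mono-≤ f f-mono q p (p∩q⊆p S I)))
  -- A `Cover` does not confine its classes to `S`; the intersection `S ∩ I` inherits independence
  -- from `I`, so hypothesis (ii) applies to it.
  (λ {I} indI → ∑1/f≤1 (S ∩ I) (independent-⊆ G (p∩q⊆q S I) indI))
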